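{- Let $M\in\Lambda^{001}_\infty$. Then $H_r(\mathcal T(M))=\mathcal T(H(M))$, where $H_r(\mathcal S)=\bigcup_{s\in\mathcal S}H_r(s)$ for a set $\mathcal S$ of resource terms.
   Context: Fix an infinite set $\mathcal V$ of variables. $\Lambda^{001}_\infty=\nu Y.\mu X.(\mathcal V+\lambda\mathcal V.X+(X)Y)$ is the set of possibly infinite syntax trees built from variables, abstractions $\lambda x.M$ and applications $(M)N$, in which every infinite branch passes infinitely often through the argument (right) subterm of an application; terms are up to α-equivalence, and $M[N/x]$ is capture-avoiding substitution. Every term is either $\lambda x_1\dots\lambda x_m.(\dots(((\lambda z.N)P)Q_1)\dots)Q_n$ (with head redex $(\lambda z.N)P$) or a head normal form $\lambda x_1\dots\lambda x_m.(\dots((y)Q_1)\dots)Q_n$. $H(M)$ is the term obtained by replacing the head redex $(\lambda z.N)P$ of $M$ by $N[P/z]$, and $H(M)=M$ if $M$ is in head normal form. Resource terms: $s::=x\mid\lambda x.s\mid\langle s\rangle\bar t$ with $\bar t$ a finite multiset of resource terms; finite sums are finite sets of resource terms, constructors extended by linearity; resource substitution $s\langle\bar t/x\rangle$ is the sum over all ways of replacing the free occurrences of $x$ in $s$ bijectively by the elements of $\bar t$ (empty sum if the counts differ). Every resource term is $\lambda x_1\dots\lambda x_m.\langle\dots\langle\langle u\rangle\bar t_1\rangle\dots\rangle\bar t_n$ with $u$ a variable (head normal form) or a head redex $\langle\lambda z.v\rangle\bar w$; $H_r(s)$ replaces the head redex by $v\langle\bar w/z\rangle$ (by linearity), and $H_r(s)=s$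 if $s$ is in head normal form. Taylor approximation: $x\ltimes x$; $\lambda x.s\ltimes\lambda x.M$ if $s\ltimes M$; $\langle s\rangle[t_1,\dots,t_n]\ltimes(M)N$ if $s\ltimes M$ and all $t_i\ltimes N$ (inductive, $n\ge0$); $\mathcal T(M)=\{s\mid s\ltimes M\}$. -}

module Defs where

open import Data.Nat using (ℕ; zero; suc; _+_; _<_; _≤_; _<ᵇ_; compare; less; equal; greater)
open import Data.Bool using (Bool; true; false; if_then_else_; _∧_)
open import Data.Maybe using (Maybe; just; nothing; Is-just)
import Data.Maybe as Maybe
open import Data.List using (List; []; _∷_; _++_; null)
open import Data.List.Relation.Unary.All using (All)
open import Data.List.Relation.Binary.Permutation.Propositional using (_↭_)
open import Data.Product using (Σ; _×_; ∃-syntax)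
open import Relation.Binary.PropositionalEquality using (_≡_)

-- Coinductive types (--guardedness / sized types) are not available in
-- this setting, so a possibly infinite syntax tree is represented by its
-- labelling function on addresses (paths from the root).  Variables are
-- de Bruijn indices in ℕ (α-equivalence built in; infinitely many free
-- variables are allowed).

data Dir : Set where
  ↓ : Dir   -- body of an abstraction
  ↙ : Dir   -- function (left) subterm of an application
  ↘ : Dir   -- argument (right) subterm of an application

Addr : Set
Addr = List Dir

data Node : Set where
  nvar : ℕ → Node
  nlam : Node
  napp : Node

Tree : Set
Tree = Addr → Maybe Node

infixl 30 _/_
_/_ : Tree → Dir → Tree
(t / d) a = t (d ∷ a)

Children : Maybe Node → (Dir → Maybe Node) → Set
Children nothing         c = c ↓ ≡ nothing × c ↙ ≡ nothing × c ↘ ≡ nothing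
Children (just (nvar x)) c = c ↓ ≡ nothing × c ↙ ≡ nothing × c ↘ ≡ nothing
Children (just nlam)     c = Is-just (c ↓) × c ↙ ≡ nothing × c ↘ ≡ nothing
Children (just napp)     c = c ↓ ≡ nothing × Is-just (c ↙) × Is-just (c ↘)

-- the inductive (μX) part: from position a, the descent through
-- abstraction bodies and function (left) subterms is finite
data Ends (t : Tree) : Addr → Set where
  evar : ∀ {a x} → t a ≡ just (nvar x) → Ends t a
  elam : ∀ {a} → t a ≡ just nlam → Ends t (a ++ ↓ ∷ []) → Ends t a
  eapp : ∀ {a} → t a ≡ just napp → Ends t (a ++ ↙ ∷ []) → Ends t a

WF : Tree → Set
WF t = Is-just (t [])
     × (∀ a → Children (t a) (λ d → t (a ++ d ∷ [])))
     × (∀ a → Is-just (t a) → Ends t a)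

bump : Dir → ℕ
bump ↓ = 1
bump ↙ = 0
bump ↘ = 0

shiftNode : ℕ → ℕ → Node → Node
shiftNode c k (nvar x) = if x <ᵇ c then nvar x else nvar (k + x)
shiftNode c k nlam     = nlam
shiftNode c k napp     = napp

shiftAt : ℕ → ℕ → Tree → Tree
shiftAt c k P []      = Maybe.map (shiftNode c k) (P [])
shiftAt c k P (s ∷ a) = shiftAt (c + bump s) k (P / s) a

-- capture-avoiding substitution  N[P/d]  (d = current binder depth),
-- removing the binder: free variables above d are decremented.
varCase : ℕ → ℕ → Tree → Tree
varCase d x P a with compare x d
... | less _ _    = if null a then just (nvar x) else nothing
... | equal _     = shiftAt 0 d P a
... | greater _ k = if null a then just (nvar (d + k)) else nothing

subAt : ℕ → Tree → Tree → Tree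
subAt d N P a with N []
... | nothing       = nothing
... | just (nvar x) = varCase d x P a
subAt d N P []      | just n = just n
subAt d N P (s ∷ a) | just n = subAt (d + bump s) (N / s) P a

_[_/0] : Tree → Tree → Tree
N [ P /0] = subAt 0 N P

-- head reduction H: walk along the λ-prefix and the left spine; the
-- first node that is an application whose function part is an abstraction
-- is the head redex and gets contracted; everything else is copied.
isLam : Maybe Node → Bool
isLam (just nlam) = true
isLam _           = false

isApp : Maybe Node → Bool
isApp (just napp) = true
isApp _           = false

H : Tree → Tree
H t a with isApp (t []) ∧ isLam (t (↙ ∷ []))
... | true  = (((t / ↙) / ↓) [ (t / ↘) /0]) a
H t []      | false = t []
H t (↓ ∷ a) | false = H (t / ↓) a
H t (↙ ∷ a) | false = H (t / ↙) a
H t (↘ ∷ a) | false = t (↘ ∷ a)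

-- Resource terms (de Bruijn); finite multisets represented by lists.

data RTerm : Set where
  var : ℕ → RTerm
  lam : RTerm → RTerm
  app : RTerm → List RTerm → RTerm

Bag : Set
Bag = List RTerm

ext : (ℕ → ℕ) → ℕ → ℕ
ext ρ zero    = zero
ext ρ (suc x) = suc (ρ x)

mutual
  rren : (ℕ → ℕ) → RTerm → RTerm
  rren ρ (var x)   = var (ρ x)
  rren ρ (lam s)   = lam (rren (ext ρ) s)
  rren ρ (app s t) = app (rren ρ s) (rrenBag ρ t)

  rrenBag : (ℕ → ℕ) → Bag → Bag
  rrenBag ρ []      = []
  rrenBag ρ (t ∷ ts) = rren ρ t ∷ rrenBag ρ ts

-- Resource substitution as a relation:
-- RSub d w̄ s u  means  u ∈ s⟨w̄ / d⟩, where d is the de Bruijn index of the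
-- substituted variable (under d binders), variables above d are decremented
-- (the binder is removed) and the elements of w̄ are shifted by d.
-- Each element of w̄ replaces exactly one occurrence of d (bijectively).
mutual
  data RSub (d : ℕ) : Bag → RTerm → RTerm → Set where
    hit   : ∀ {w} → RSub d (w ∷ []) (var d) (rren (d +_) w)
    below : ∀ {x} → x < d → RSub d [] (var x) (var x)
    above : ∀ {y} → d ≤ y → RSub d [] (var (suc y)) (var y)
    lam   : ∀ {w̄ s u} → RSub (suc d) w̄ s u → RSub d w̄ (lam s) (lam u)
    app   : ∀ {w̄ w̄₁ w̄₂ s u t̄ v̄} → w̄ ↭ w̄₁ ++ w̄₂ →
            RSub d w̄₁ s u → RSubBag d w̄₂ t̄ v̄ →
            RSub d w̄ (app s t̄) (app u v̄)

  data RSubBag (d : ℕ) : Bag → Bag → Bag → Set where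
    []  : RSubBag d [] [] []
    _∷_ : ∀ {w̄ w̄₁ w̄₂ t t̄ v v̄} → w̄ ↭ w̄₁ ++ w̄₂ × RSub d w̄₁ t v →
          RSubBag d w̄₂ t̄ v̄ → RSubBag d w̄ (t ∷ t̄) (v ∷ v̄)

-- Head reduction of resource terms: Hr s u  means  u ∈ H_r(s).
-- HrSpine handles the applicative part below the λ-prefix.
data HrSpine : RTerm → RTerm → Set where
  hvar : ∀ {x} → HrSpine (var x) (var x)
  beta : ∀ {v w̄ u} → RSub 0 w̄ v u → HrSpine (app (lam v) w̄) u
  appl : ∀ {s u t̄} → HrSpine s u → HrSpine (app s t̄) (app u t̄)

data Hr : RTerm → RTerm → Set where
  lam   : ∀ {s u} → Hr s u → Hr (lam s) (lam u)
  spine : ∀ {s u} → HrSpine s u → Hr s u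

data _⋉_ : RTerm → Tree → Set where
  var : ∀ {x M} → M [] ≡ just (nvar x) → var x ⋉ M
  lam : ∀ {s M} → M [] ≡ just nlam → s ⋉ (M / ↓) → lam s ⋉ M
  app : ∀ {s M t̄} → M [] ≡ just napp → s ⋉ (M / ↙) →
        All (λ t → t ⋉ (M / ↘)) t̄ → app s t̄ ⋉ M

_∈𝒯_ : RTerm → Tree → Set
u ∈𝒯 M = u ⋉ M

_∈Hr𝒯_ : RTerm → Tree → Set
u ∈Hr𝒯 M = ∃[ s ] (s ⋉ M × Hr s u)

{-# OPTIONS --safe #-}
-- H walks down the λ-prefix and the left spine of M exactly as H_r walks down
-- an approximant s ⋉ M, so both contract the same head redex (λ.N)P and the
-- theorem reduces to
--   𝒯(N[P/0]) = { u | u ∈ s⟨w̄/0⟩, s ⋉ N, w̄ ⊆ 𝒯(P) }.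
-- This is proved by induction on the resource term at an arbitrary binder
-- depth d; at an occurrence of d it needs that the approximants of P shifted
-- by d are exactly the shifted approximants of P.  Everything is local to the
-- nodes visited.
module Submission where

open import Defs
open import Data.Bool using (Bool; true; false; _∧_; if_then_else_)
open import Data.Empty using (⊥; ⊥-elim)
open import Data.List using ([]; _∷_; _++_; null)
open import Data.List.Relation.Binary.Permutation.Propositional using (↭-refl)
open import Data.List.Relation.Binary.Permutation.Propositional.Properties using (All-resp-↭)
open import Data.List.Relation.Unary.All using (All; []; _∷_)
open import Data.List.Relation.Unary.All.Properties using (++⁺; ++⁻)
open import Data.Maybe using (just; nothing)
import Data.Maybe as Maybe
open import Data.Nat using (ℕ; zero; suc; _+_; _<_; _≤_; _<ᵇ_; compare; less; equal; greater; s≤s)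
open import Data.Nat.Properties using (+-comm; +-suc; +-identityʳ; <-cmp; <-irrefl; <-trans; ≤-trans; m≤m+n; n≤1+n; m≢1+m+n)
open import Data.Product using (_×_; _,_; ∃-syntax)
open import Function using (_∘_)
open import Relation.Binary.Definitions using (tri<; tri≈; tri>)
open import Relation.Binary.PropositionalEquality using (_≡_; refl; sym; trans; cong; cong₂; subst; _≗_)

mutual
  ⋉-resp-≗ : ∀ {s M M′} → M ≗ M′ → s ⋉ M → s ⋉ M′
  ⋉-resp-≗ e (var p)      = var (trans (sym (e [])) p)
  ⋉-resp-≗ e (lam p q)    = lam (trans (sym (e [])) p) (⋉-resp-≗ (e ∘ (↓ ∷_)) q)
  ⋉-resp-≗ e (app p q qs) =
    app (trans (sym (e [])) p) (⋉-resp-≗ (e ∘ (↙ ∷_)) q) (All-⋉-resp-≗ (e ∘ (↘ ∷_)) qs)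

  All-⋉-resp-≗ : ∀ {t̄ M M′} → M ≗ M′ → All (_⋉ M) t̄ → All (_⋉ M′) t̄
  All-⋉-resp-≗ e []       = []
  All-⋉-resp-≗ e (q ∷ qs) = ⋉-resp-≗ e q ∷ All-⋉-resp-≗ e qs

⋉-root-defined : ∀ {s M} → s ⋉ M → M [] ≡ nothing → ⊥
⋉-root-defined (var p)     e with trans (sym e) p
... | ()
⋉-root-defined (lam p _)   e with trans (sym e) p
... | ()
⋉-root-defined (app p _ _) e with trans (sym e) p
... | ()

data NotVar : Node → Set where
  nlam : NotVar nlam
  napp : NotVar napp

just-nvar-injective : ∀ {x y} → just (nvar x) ≡ just (nvar y) → x ≡ y
just-nvar-injective refl = refl

shiftVar : ℕ → ℕ → ℕ → ℕ
shiftVar c k x = if x <ᵇ c then x else k + x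

shiftNode-nvar : ∀ c k x → shiftNode c k (nvar x) ≡ nvar (shiftVar c k x)
shiftNode-nvar c k x with x <ᵇ c
... | true  = refl
... | false = refl

shiftNode-nvar≢ : ∀ c k x {n} → just (shiftNode c k (nvar x)) ≡ just n → NotVar n → ⊥
shiftNode-nvar≢ c k x e nv rewrite shiftNode-nvar c k x with e | nv
... | refl | ()

ext-shiftVar : ∀ c k x → ext (shiftVar c k) x ≡ shiftVar (c + 1) k x
ext-shiftVar c k x rewrite +-comm c 1 = go x
  where
  go : ∀ x → ext (shiftVar c k) x ≡ shiftVar (suc c) k x
  go zero    = refl
  go (suc x) with x <ᵇ c
  ... | true  = refl
  ... | false = sym (+-suc k x)

ext-cong : ∀ {f g : ℕ → ℕ} → f ≗ g → ext f ≗ ext g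
ext-cong e zero    = refl
ext-cong e (suc x) = cong suc (e x)

mutual
  rren-cong : ∀ {f g : ℕ → ℕ} → f ≗ g → rren f ≗ rren g
  rren-cong e (var x)   = cong var (e x)
  rren-cong e (lam s)   = cong lam (rren-cong (ext-cong e) s)
  rren-cong e (app s t̄) = cong₂ app (rren-cong e s) (rrenBag-cong e t̄)

  rrenBag-cong : ∀ {f g : ℕ → ℕ} → f ≗ g → rrenBag f ≗ rrenBag g
  rrenBag-cong e []       = refl
  rrenBag-cong e (t ∷ t̄) = cong₂ _∷_ (rren-cong e t) (rrenBag-cong e t̄)

-- Application children are visited at cutoff c + bump ↙ = c + 0.
rren-shiftVar-+0 : ∀ c k → rren (shiftVar (c + 0) k) ≗ rren (shiftVar c k)
rren-shiftVar-+0 c k s = cong (λ c′ → rren (shiftVar c′ k) s) (+-identityʳ c)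

rrenBag-shiftVar-+0 : ∀ c k → rrenBag (shiftVar (c + 0) k) ≗ rrenBag (shiftVar c k)
rrenBag-shiftVar-+0 c k t̄ = cong (λ c′ → rrenBag (shiftVar c′ k) t̄) (+-identityʳ c)

mutual
  ⋉-shift⁺ : ∀ c k {P w} → w ⋉ P → rren (shiftVar c k) w ⋉ shiftAt c k P
  ⋉-shift⁺ c k (var {x} p) =
    var (trans (cong (Maybe.map (shiftNode c k)) p) (cong just (shiftNode-nvar c k x)))
  ⋉-shift⁺ c k (lam {s} p q) =
    lam (cong (Maybe.map (shiftNode c k)) p)
        (subst (_⋉ _) (sym (rren-cong (ext-shiftVar c k) s)) (⋉-shift⁺ (c + 1) k q))
  ⋉-shift⁺ c k (app {s} {t̄ = t̄} p q qs) =
    app (cong (Maybe.map (shiftNode c k)) p)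
        (subst (_⋉ _) (rren-shiftVar-+0 c k s) (⋉-shift⁺ (c + 0) k q))
        (subst (All (_⋉ _)) (rrenBag-shiftVar-+0 c k t̄) (All-⋉-shift⁺ (c + 0) k qs))

  All-⋉-shift⁺ : ∀ c k {P w̄} → All (_⋉ P) w̄ → All (_⋉ shiftAt c k P) (rrenBag (shiftVar c k) w̄)
  All-⋉-shift⁺ c k []       = []
  All-⋉-shift⁺ c k (q ∷ qs) = ⋉-shift⁺ c k q ∷ All-⋉-shift⁺ c k qs

mutual
  ⋉-shift⁻ : ∀ u c k P → u ⋉ shiftAt c k P → ∃[ w ] (w ⋉ P × rren (shiftVar c k) w ≡ u)
  ⋉-shift⁻ (var y) c k P (var p) with P [] in e
  ... | just (nvar x) =
    var x , var e , cong var (just-nvar-injective (trans (cong just (sym (shiftNode-nvar c k x))) p))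
  ⋉-shift⁻ (lam u) c k P (lam p q) with P [] in e
  ... | just (nvar x) = ⊥-elim (shiftNode-nvar≢ c k x p nlam)
  ... | just nlam with ⋉-shift⁻ u (c + 1) k (P / ↓) q
  ...   | w , qw , ê = lam w , lam e qw , cong lam (trans (rren-cong (ext-shiftVar c k) w) ê)
  ⋉-shift⁻ (app u t̄) c k P (app p q qs) with P [] in e
  ... | just (nvar x) = ⊥-elim (shiftNode-nvar≢ c k x p napp)
  ... | just napp with ⋉-shift⁻ u (c + 0) k (P / ↙) q | All-⋉-shift⁻ t̄ (c + 0) k (P / ↘) qs
  ...   | w , qw , ê | w̄ , qw̄ , ē =
    app w w̄ , app e qw qw̄ ,
    cong₂ app (trans (sym (rren-shiftVar-+0 c k w)) ê) (trans (sym (rrenBag-shiftVar-+0 c k w̄)) ē)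

  All-⋉-shift⁻ : ∀ t̄ c k P → All (_⋉ shiftAt c k P) t̄ →
                 ∃[ w̄ ] (All (_⋉ P) w̄ × rrenBag (shiftVar c k) w̄ ≡ t̄)
  All-⋉-shift⁻ []       c k P []       = [] , [] , refl
  All-⋉-shift⁻ (t ∷ t̄) c k P (q ∷ qs) with ⋉-shift⁻ t c k P q | All-⋉-shift⁻ t̄ c k P qs
  ... | w , qw , e | w̄ , qw̄ , ē = w ∷ w̄ , qw ∷ qw̄ , cong₂ _∷_ e ē

leaf : ℕ → Tree
leaf x []      = just (nvar x)
leaf x (_ ∷ _) = nothing

if-null-leaf : ∀ x a → (if null a then just (nvar x) else nothing) ≡ leaf x a
if-null-leaf x []      = refl
if-null-leaf x (_ ∷ _) = refl

⋉-leaf⁻ : ∀ {u M x} → u ⋉ M → M ≗ leaf x → u ≡ var x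
⋉-leaf⁻ (var p)     e = cong var (just-nvar-injective (trans (sym p) (e [])))
⋉-leaf⁻ (lam p _)   e with trans (sym p) (e [])
... | ()
⋉-leaf⁻ (app p _ _) e with trans (sym p) (e [])
... | ()

varCase-< : ∀ {d x} P → x < d → varCase d x P ≗ leaf x
varCase-< {d} {x} P x<d a with compare x d
... | less _ _    = if-null-leaf x a
... | equal _     = ⊥-elim (<-irrefl refl x<d)
... | greater _ k = ⊥-elim (<-irrefl refl (<-trans (s≤s (m≤m+n d k)) x<d))

varCase-≡ : ∀ {d x} P → x ≡ d → varCase d x P ≗ shiftAt 0 d P
varCase-≡ {d} {x} P x≡d a with compare x d
... | less _ k    = ⊥-elim (m≢1+m+n x x≡d)
... | equal _     = refl
... | greater _ k = ⊥-elim (m≢1+m+n d (sym x≡d))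

varCase-> : ∀ {d y} P → d ≤ y → varCase d (suc y) P ≗ leaf y
varCase-> {d} {y} P d≤y a with compare (suc y) d
... | less _ k    = ⊥-elim (<-irrefl refl (≤-trans (s≤s (≤-trans (n≤1+n y) (m≤m+n (suc y) k))) d≤y))
... | equal _     = ⊥-elim (<-irrefl refl d≤y)
... | greater _ k = if-null-leaf (d + k) a

subAt-+1 : ∀ d N P → subAt (d + 1) N P ≗ subAt (suc d) N P
subAt-+1 d N P a = cong (λ d′ → subAt d′ N P a) (+-comm d 1)

subAt-+0 : ∀ d N P → subAt (d + 0) N P ≗ subAt d N P
subAt-+0 d N P a = cong (λ d′ → subAt d′ N P a) (+-identityʳ d)

mutual
  ⋉-subAt⁺ : ∀ {d w̄ s u N P} → RSub d w̄ s u → s ⋉ N → All (_⋉ P) w̄ → u ⋉ subAt d N P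
  ⋉-subAt⁺ {d} {P = P} hit (var e) (qw ∷ []) rewrite e =
    ⋉-resp-≗ (sym ∘ varCase-≡ P refl) (⋉-shift⁺ 0 d qw)
  ⋉-subAt⁺ {P = P} (below x<d) (var e) [] rewrite e = var (varCase-< P x<d [])
  ⋉-subAt⁺ {P = P} (above d≤y) (var e) [] rewrite e = var (varCase-> P d≤y [])
  ⋉-subAt⁺ {d} {N = N} {P} (lam r) (lam e q) qw̄ rewrite e =
    lam refl (⋉-resp-≗ (sym ∘ subAt-+1 d (N / ↓) P) (⋉-subAt⁺ r q qw̄))
  ⋉-subAt⁺ {d} {N = N} {P} (app {w̄₁ = w̄₁} w̄↭ r rs) (app e q qs) qw̄ rewrite e
    with ++⁻ w̄₁ (All-resp-↭ w̄↭ qw̄)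
  ... | qw̄₁ , qw̄₂ =
    app refl (⋉-resp-≗ (sym ∘ subAt-+0 d (N / ↙) P) (⋉-subAt⁺ r q qw̄₁))
             (All-⋉-resp-≗ (sym ∘ subAt-+0 d (N / ↘) P) (All-⋉-subAt⁺ rs qs qw̄₂))

  All-⋉-subAt⁺ : ∀ {d w̄ t̄ v̄ N P} → RSubBag d w̄ t̄ v̄ → All (_⋉ N) t̄ → All (_⋉ P) w̄ →
                 All (_⋉ subAt d N P) v̄
  All-⋉-subAt⁺ [] [] [] = []
  All-⋉-subAt⁺ (_∷_ {w̄₁ = w̄₁} (w̄↭ , r) rs) (q ∷ qs) qw̄ with ++⁻ w̄₁ (All-resp-↭ w̄↭ qw̄)
  ... | qw̄₁ , qw̄₂ = ⋉-subAt⁺ r q qw̄₁ ∷ All-⋉-subAt⁺ rs qs qw̄₂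

ApproxSubst : ℕ → Tree → Tree → RTerm → Set
ApproxSubst d N P u = ∃[ s ] ∃[ w̄ ] (s ⋉ N × All (_⋉ P) w̄ × RSub d w̄ s u)

⋉-varCase⁻ : ∀ u d N P x → N [] ≡ just (nvar x) → u ⋉ varCase d x P → ApproxSubst d N P u
⋉-varCase⁻ u d N P x e D with <-cmp x d
... | tri< x<d _ _ =
  var x , [] , var e , [] , subst (RSub d [] (var x)) (sym (⋉-leaf⁻ D (varCase-< P x<d))) (below x<d)
... | tri≈ _ refl _ with ⋉-shift⁻ u 0 d P (⋉-resp-≗ (varCase-≡ P refl) D)
...   | w , qw , refl = var d , w ∷ [] , var e , qw ∷ [] , hit
⋉-varCase⁻ u d N P (suc y) e D | tri> _ _ (s≤s d≤y) =
  var (suc y) , [] , var e , [] ,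
  subst (RSub d [] (var (suc y))) (sym (⋉-leaf⁻ D (varCase-> P d≤y))) (above d≤y)

mutual
  ⋉-subAt⁻ : ∀ u d N P → u ⋉ subAt d N P → ApproxSubst d N P u
  -- Abstracting N [] also unfolds subAt d N P in the type of D.
  ⋉-subAt⁻ u d N P D with N [] in e
  ... | nothing       = ⊥-elim (⋉-root-defined D refl)
  ... | just (nvar x) = ⋉-varCase⁻ u d N P x e D
  ⋉-subAt⁻ (var _)   d N P (var ())     | just nlam
  ⋉-subAt⁻ (app _ _) d N P (app () _ _) | just nlam
  ⋉-subAt⁻ (lam u)   d N P (lam _ q)    | just nlam
    with ⋉-subAt⁻ u (suc d) (N / ↓) P (⋉-resp-≗ (subAt-+1 d (N / ↓) P) q)
  ... | s , w̄ , qs , qw̄ , r = lam s , w̄ , lam e qs , qw̄ , lam r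
  ⋉-subAt⁻ (var _)   d N P (var ())     | just napp
  ⋉-subAt⁻ (lam _)   d N P (lam () _)   | just napp
  ⋉-subAt⁻ (app u t̄) d N P (app _ q qs) | just napp
    with ⋉-subAt⁻ u d (N / ↙) P (⋉-resp-≗ (subAt-+0 d (N / ↙) P) q)
       | All-⋉-subAt⁻ t̄ d (N / ↘) P (All-⋉-resp-≗ (subAt-+0 d (N / ↘) P) qs)
  ... | s , w̄₁ , qs₁ , qw̄₁ , r | t̄′ , w̄₂ , qt̄′ , qw̄₂ , rs =
    app s t̄′ , w̄₁ ++ w̄₂ , app e qs₁ qt̄′ , ++⁺ qw̄₁ qw̄₂ , app ↭-refl r rs

  All-⋉-subAt⁻ : ∀ v̄ d N P → All (_⋉ subAt d N P) v̄ →
                 ∃[ t̄ ] ∃[ w̄ ] (All (_⋉ N) t̄ × All (_⋉ P) w̄ × RSubBag d w̄ t̄ v̄)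
  All-⋉-subAt⁻ []       d N P []       = [] , [] , [] , [] , []
  All-⋉-subAt⁻ (v ∷ v̄) d N P (q ∷ qs) with ⋉-subAt⁻ v d N P q | All-⋉-subAt⁻ v̄ d N P qs
  ... | s , w̄₁ , qs₁ , qw̄₁ , r | t̄ , w̄₂ , qt̄ , qw̄₂ , rs =
    s ∷ t̄ , w̄₁ ++ w̄₂ , qs₁ ∷ qt̄ , ++⁺ qw̄₁ qw̄₂ , (↭-refl , r) ∷ rs

redex? : Tree → Bool
redex? M = isApp (M []) ∧ isLam (M (↙ ∷ []))

redex?-napp : ∀ {M} → M [] ≡ just napp → redex? M ≡ isLam (M (↙ ∷ []))
redex?-napp e rewrite e = refl

redex?⁻ : ∀ {M} → redex? M ≡ true → M [] ≡ just napp × M (↙ ∷ []) ≡ just nlam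
redex?⁻ {M} e with M [] | M (↙ ∷ []) | e
... | just napp | just nlam | refl = refl , refl

isLam-HrSpine : ∀ {s u M} → s ⋉ M → HrSpine s u → isLam (M []) ≡ false
isLam-HrSpine (var p)     hvar rewrite p = refl
isLam-HrSpine (app p _ _) _    rewrite p = refl

Hr⇒HrSpine : ∀ {s u M} → s ⋉ M → isLam (M []) ≡ false → Hr s u → HrSpine s u
Hr⇒HrSpine (lam p _) e (lam _) rewrite p with e
... | ()
Hr⇒HrSpine _ _ (spine h) = h

mutual
  Hr-⋉-H : ∀ {M s u} → s ⋉ M → Hr s u → u ⋉ H M
  Hr-⋉-H (lam p q) (lam h) rewrite p = lam p (Hr-⋉-H q h)
  Hr-⋉-H D (spine h) = HrSpine-⋉-H D h

  HrSpine-⋉-H : ∀ {M s u} → s ⋉ M → HrSpine s u → u ⋉ H M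
  HrSpine-⋉-H (var p) hvar rewrite p = var p
  HrSpine-⋉-H {M} (app p (lam p′ q) qs) (beta r)
    rewrite trans (redex?-napp {M} p) (cong isLam p′) = ⋉-subAt⁺ r q qs
  HrSpine-⋉-H {M} (app p q qs) (appl h)
    rewrite trans (redex?-napp {M} p) (isLam-HrSpine q h) = app p (HrSpine-⋉-H q h) qs

⋉-H-Hr : ∀ u M → u ⋉ H M → ∃[ s ] (s ⋉ M × Hr s u)
⋉-H-Hr u M D with isApp (M []) ∧ isLam (M (↙ ∷ [])) in e
... | true with redex?⁻ {M} e | ⋉-subAt⁻ u 0 ((M / ↙) / ↓) (M / ↘) D
...   | p , p′ | s , w̄ , qs , qw̄ , r = app (lam s) w̄ , app p (lam p′ qs) qw̄ , spine (beta r)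
⋉-H-Hr (var y) M (var p) | false = var y , var p , spine hvar
⋉-H-Hr (lam u) M (lam p q) | false with ⋉-H-Hr u (M / ↓) q
... | s , qs , h = lam s , lam p qs , lam h
⋉-H-Hr (app u t̄) M (app p q qs) | false with ⋉-H-Hr u (M / ↙) q
... | s , qs′ , h = app s t̄ , app p qs′ qs , spine (appl (Hr⇒HrSpine qs′ notLam h))
  where
  notLam = trans (sym (redex?-napp {M} p)) e

lemma5p4 : (M : Tree) → WF M → (u : RTerm) → ((u ∈Hr𝒯 M → u ∈𝒯 H M) × (u ∈𝒯 H M → u ∈Hr𝒯 M))
lemma5p4 M _ u = (λ { (s , q , h) → Hr-⋉-H q h }) , ⋉-H-Hr u M
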